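{- Let $k\ge 1$ and let $G$ be a minimally $k$-connected graph with $n$ vertices and maximum degree $\Delta$. Then $$|V_k|\;\ge\;\frac{(k-1)n+2\,(c_F+|E_k|)+\max\{0,\Delta-(k+1)\}}{2k-1}.$$
   Context: All graphs are finite, simple and undirected. A $k$-separator is a set of $k\ge 0$ vertices whose deletion leaves a disconnected graph. A graph is $k$-connected if it has more than $k$ vertices and contains no $(k-1)$-separator. A $k$-connected graph $G$ is minimally $k$-connected if $G-e$ is not $k$-connected for every edge $e$. For a graph $G$: $V_k$ is the set of vertices of degree exactly $k$; $E_k$ is the set of edges of $G$ with both end vertices in $V_k$; $F:=G-V_k$ is the graph obtained by deleting $V_k$; and $c_F$ is the number of connected components of $F$. -}

module Defs where

open import Data.Fin.Base using (Fin; _<_)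
open import Data.Fin.Properties using (_≟_; _<?_)
open import Data.Fin.Subset using (Subset; _∈_; _∉_; _⊆_; ∣_∣) renaming (_─_ to _∖_)
open import Data.Fin.Subset.Properties using (_∈?_; x∈p∧x∉q⇒x∈p─q)
open import Data.List.Base using (List; map; filter; allFin; cartesianProduct)
open import Data.List.Extrema.Nat using (max)
open import Data.Nat.Base using (ℕ; suc; pred; _+_; _*_; _∸_; _>_; NonZero)
import Data.Nat.Properties as ℕ
open import Data.Product.Base using (Σ; ∃; _×_; _,_; proj₁)
open import Data.Sum.Base using (_⊎_)
import Data.Sum.Base as Sum
open import Data.Vec.Base using (tabulate)
open import Function.Base using (_∘_; _on_)
open import Function.Bundles using (Bijection)
open import Level using (0ℓ)
open import Relation.Binary.Bundles using (Setoid)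
open import Relation.Binary.Core using (Rel)
open import Relation.Binary.Definitions using (Decidable; Symmetric; Irreflexive)
open import Relation.Binary.Construct.Closure.ReflexiveTransitive using (Star; ε; _◅◅_; reverse)
open import Relation.Binary.PropositionalEquality using (_≡_; setoid)
open import Relation.Nullary using (¬_; does; _×-dec_; _⊎-dec_; ¬?)
import Relation.Unary as U

-- A finite simple graph.  Its vertex set is an arbitrary subset of Fin N, so
-- that deleting vertices again gives a Graph N.
record Graph (N : ℕ) : Set₁ where
  infix 4 _~_ _~?_
  field
    V       : Subset N
    _~_     : Rel (Fin N) 0ℓ
    _~?_    : Decidable _~_
    ~-sym   : Symmetric _~_
    ~-irrefl : Irreflexive _≡_ _~_
    ~⇒∈V    : ∀ {u v} → u ~ v → u ∈ V

open Graph using (V)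

private
  variable
    N : ℕ

comprehension : {P : U.Pred (Fin N) 0ℓ} → U.Decidable P → Subset N
comprehension P? = tabulate (does ∘ P?)

order : Graph N → ℕ
order G = ∣ V G ∣

-- Each edge is listed once, as the pair (u , v) with u < v.
edges : Graph N → List (Fin N × Fin N)
edges {N} G = filter (λ (u , v) → (u <? v) ×-dec (u ~? v))
                     (cartesianProduct (allFin N) (allFin N))
  where open Graph G

neighbours : Graph N → Fin N → Subset N
neighbours G u = comprehension (u ~?_)
  where open Graph G

degree : Graph N → Fin N → ℕ
degree G u = ∣ neighbours G u ∣

maxDegree : Graph N → ℕ
maxDegree {N} G = max 0 (map (degree G) (filter (_∈? V G) (allFin N)))

deleteVertices : Graph N → Subset N → Graph N
deleteVertices G S = record
  { V        = V G ∖ S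
  ; _~_      = λ u v → u ~ v × u ∉ S × v ∉ S
  ; _~?_     = λ u v → (u ~? v) ×-dec (¬? (u ∈? S) ×-dec ¬? (v ∈? S))
  ; ~-sym    = λ (u~v , u∉S , v∉S) → ~-sym u~v , v∉S , u∉S
  ; ~-irrefl = λ u≡v → ~-irrefl u≡v ∘ proj₁
  ; ~⇒∈V     = λ (u~v , u∉S , _) → x∈p∧x∉q⇒x∈p─q (~⇒∈V u~v) u∉S
  }
  where open Graph G hiding (V)

deleteEdge : Graph N → Fin N → Fin N → Graph N
deleteEdge {N} G a b = record
  { V        = V G
  ; _~_      = λ u v → u ~ v × ¬ IsAB u v
  ; _~?_     = λ u v → (u ~? v) ×-dec ¬? (((u ≟ a) ×-dec (v ≟ b)) ⊎-dec ((u ≟ b) ×-dec (v ≟ a)))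
  ; ~-sym    = λ (u~v , ¬ab) → ~-sym u~v , ¬ab ∘ swapAB
  ; ~-irrefl = λ u≡v → ~-irrefl u≡v ∘ proj₁
  ; ~⇒∈V     = ~⇒∈V ∘ proj₁
  }
  where
  open Graph G hiding (V)

  IsAB : Rel (Fin N) 0ℓ
  IsAB u v = (u ≡ a × v ≡ b) ⊎ (u ≡ b × v ≡ a)

  swapAB : Symmetric IsAB
  swapAB = Sum.swap ∘ Sum.map (λ (p , q) → q , p) (λ (p , q) → q , p)

Reachable : Graph N → Rel (Fin N) 0ℓ
Reachable G = Star (Graph._~_ G)

Connected : Graph N → Set
Connected G = ∀ {u v} → u ∈ V G → v ∈ V G → Reachable G u v

Disconnected : Graph N → Set
Disconnected G = ¬ Connected G

IsSeparator : Graph N → ℕ → Subset N → Set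
IsSeparator G k S = S ⊆ V G × ∣ S ∣ ≡ k × Disconnected (deleteVertices G S)

IsConnected : (k : ℕ) .{{_ : NonZero k}} → Graph N → Set
IsConnected k G = order G > k × ¬ ∃ (IsSeparator G (pred k))

IsMinimallyConnected : (k : ℕ) .{{_ : NonZero k}} → Graph N → Set
IsMinimallyConnected k G =
  IsConnected k G × (∀ u v → u ~ v → ¬ IsConnected k (deleteEdge G u v))
  where open Graph G

-- The quotient of the vertex set by reachability, as a setoid: its elements up
-- to _≈_ are the connected components.
components : Graph N → Setoid 0ℓ 0ℓ
components {N} G = record
  { Carrier = Σ (Fin N) (_∈ V G)
  ; _≈_     = Reachable G on proj₁
  ; isEquivalence = record
    { refl  = ε
    ; sym   = reverse (Graph.~-sym G)
    ; trans = _◅◅_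
    }
  }

HasComponentCount : Graph N → ℕ → Set
HasComponentCount G c = Bijection (components G) (setoid (Fin c))

verticesOfDegree : ℕ → Graph N → Subset N
verticesOfDegree k G = comprehension (λ v → (v ∈? V G) ×-dec (degree G v ℕ.≟ k))

edgesOfDegree : ℕ → Graph N → List (Fin N × Fin N)
edgesOfDegree k G = filter (λ (u , v) → (u ∈? Vₖ) ×-dec (v ∈? Vₖ)) (edges G)
  where Vₖ = verticesOfDegree k G

2k∸1-nonZero : ∀ k → .{{NonZero k}} → NonZero (2 * k ∸ 1)
2k∸1-nonZero (suc k) rewrite ℕ.+-suc k (k + 0) = _

{-# OPTIONS --safe #-}
module Submission where

-- For an edge u ~ v fix a set of k - 1 vertices separating u from v in G - uv,
-- and weigh u → v by the number of vertices on the side of v.  If y ~ x ~ z,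
-- y ≢ z and x has degree greater than k, uncrossing the two separators gives
-- weight (x → z) < weight (y → x).  Directing each edge of F towards its heavier
-- side, every vertex then has out-degree at most 1, and a directed walk has
-- decreasing weights, so each component contains a sink: F has at most
-- ∣ F ∣ - c_F edges (Mader: F is a forest).  The bound follows by counting the
-- edges between V_k and F from both sides.  Separators and reachability are only
-- available under double negation, which the final inequality absorbs.

import Algebra.Properties.Semiring.Sum as Semiring
open import Data.Bool.Base using (Bool; true; false; T)
open import Data.Bool.Properties using (T?)
open import Data.Empty using (⊥)
import Data.Fin.Base as Fin
open import Data.Fin.Base using (Fin; zero; suc)
import Data.Fin.Properties as Fin
open import Data.Fin.Properties using (_≟_; any?; <-cmp; _<?_; sequence)
open import Data.Fin.Subset using (Subset; inside; outside; _∈_; _∉_; _⊆_; ∣_∣; _─_)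
open import Data.Fin.Subset.Properties using (_∈?_; drop-∷-⊆; s⊆s; out⊆; x∈p∧x∉q⇒x∈p─q; p─q⊆p)
import Data.Integer.Base as ℤ
open import Data.Integer.Base using (+_; +≤+)
import Data.Integer.Properties as ℤ
open import Data.List.Base using (List; []; _∷_; length; filter; map; tabulate; allFin; cartesianProduct; _++_)
open import Data.List.Extrema.Nat using (max≤v⁺)
open import Data.List.Properties using (filter-++; length-++; map-tabulate)
import Data.List.Relation.Unary.All as All
import Data.List.Relation.Unary.All.Properties as All
open import Data.Nat.Base using (ℕ; zero; suc; NonZero; _+_; _*_; _∸_; _≤_; _<_; z≤n; s≤s)
open import Data.Nat.Induction using (Acc; acc; <-wellFounded)
import Data.Nat.Properties as ℕ
open import Data.Nat.Solver using (module +-*-Solver)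
open import Data.Product.Base using (∃; _×_; _,_; proj₁; proj₂)
open import Data.Rational.Base using (_/_; _≥_)
open import Data.Rational.Properties using (toℚᵘ-cancel-≤; toℚᵘ-fromℚᵘ)
import Data.Rational.Unnormalised.Base as ℚᵘ
import Data.Rational.Unnormalised.Properties as ℚᵘ
open import Data.Sum.Base using (_⊎_; inj₁; inj₂; [_,_]′)
open import Data.Vec.Base using ([]; _∷_; here; there)
open import Data.Vec.Properties using (lookup∘tabulate; []=⇒lookup; lookup⇒[]=)
open import Effect.Monad using (RawMonad)
open import Function.Base using (_∘_; id)
open import Function.Bundles using (Bijection)
open import Level using (0ℓ)
open import Relation.Binary.Construct.Closure.ReflexiveTransitive using (ε; _◅_; _◅◅_; reverse; return; kleisliStar)
open import Relation.Binary.Core using (Rel)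
import Relation.Binary.Definitions as B
open import Relation.Binary.Definitions using (tri<; tri≈; tri>)
open import Relation.Binary.PropositionalEquality using (_≡_; _≢_; refl; sym; trans; cong; cong₂; subst; module ≡-Reasoning)
open import Relation.Nullary using (¬_; Dec; yes; no; does; contradiction; _×-dec_; _⊎-dec_; ¬?)
open import Relation.Nullary.Decidable using (dec-true; dec-false; decidable-stable; ¬¬-excluded-middle)
open import Relation.Nullary.Negation using (¬¬-Monad; ¬¬-map)
open import Relation.Unary using (Pred; Decidable)
open import Defs

open Semiring ℕ.+-*-semiring using (sum; sum-cong-≗; ∑-distrib-+; ∑-comm; *-distribʳ-sum)

private
  variable
    m n N : ℕ
    A B C : Set

-- Indicators and finite sums

⟦_⟧ : Bool → ℕ
⟦ true ⟧  = 1
⟦ false ⟧ = 0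

𝟙 : Dec A → ℕ
𝟙 A? = ⟦ does A? ⟧

𝟙-yes : (A? : Dec A) → A → 𝟙 A? ≡ 1
𝟙-yes A? a = cong ⟦_⟧ (dec-true A? a)

𝟙-no : (A? : Dec A) → ¬ A → 𝟙 A? ≡ 0
𝟙-no A? ¬a = cong ⟦_⟧ (dec-false A? ¬a)

𝟙≡0⇒¬ : (A? : Dec A) → 𝟙 A? ≡ 0 → ¬ A
𝟙≡0⇒¬ A? eq a with () ← trans (sym eq) (𝟙-yes A? a)

-- Companion of `∑<∑⇒∃<`: at an index where a sum of counting terms stays below an indicator, `A`
-- holds and all those terms vanish. This is how a vertex avoiding prescribed sets is found.
<𝟙⇒ : ∀ {m} (A? : Dec A) → m < 𝟙 A? → A × m ≡ 0
<𝟙⇒ (yes a) m<1 = a , ℕ.n<1⇒n≡0 m<1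

𝟙-mono : (A? : Dec A) (B? : Dec B) → (A → B) → 𝟙 A? ≤ 𝟙 B?
𝟙-mono (no _)  B? f = z≤n
𝟙-mono (yes a) B? f = ℕ.≤-reflexive (sym (𝟙-yes B? (f a)))

𝟙-cong : (A? : Dec A) (B? : Dec B) → (A → B) → (B → A) → 𝟙 A? ≡ 𝟙 B?
𝟙-cong A? B? f g = ℕ.≤-antisym (𝟙-mono A? B? f) (𝟙-mono B? A? g)

𝟙-⊎ : (A? : Dec A) (B? : Dec B) → 𝟙 (A? ⊎-dec B?) ≤ 𝟙 A? + 𝟙 B?
𝟙-⊎ (yes _) _ = s≤s z≤n
𝟙-⊎ (no _)  _ = ℕ.≤-refl

𝟙-split : (A? : Dec A) (B? : Dec B) (C? : Dec C) →
          (A → B ⊎ C) → (B → A) → (C → A) → (B → ¬ C) → 𝟙 A? ≡ 𝟙 B? + 𝟙 C?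
𝟙-split A? (yes b) C? _ f _ b⇒¬c rewrite 𝟙-no C? (b⇒¬c b) = 𝟙-yes A? (f b)
𝟙-split A? (no ¬b) C? split _ g _ = 𝟙-cong A? C? (λ a → a⇒c (split a)) g
  where
  a⇒c : _ ⊎ _ → _
  a⇒c (inj₁ b) = contradiction b ¬b
  a⇒c (inj₂ c) = c

∑-mono : (f g : Fin n → ℕ) → (∀ i → f i ≤ g i) → sum f ≤ sum g
∑-mono {zero}  f g f≤g = z≤n
∑-mono {suc n} f g f≤g = ℕ.+-mono-≤ (f≤g zero) (∑-mono (f ∘ suc) (g ∘ suc) (f≤g ∘ suc))

∑<∑⇒∃< : (f g : Fin n → ℕ) → sum f < sum g → ∃ λ i → f i < g i
∑<∑⇒∃< f g ∑f<∑g with any? (λ i → f i ℕ.<? g i)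
... | yes ∃i = ∃i
... | no ¬∃i = contradiction (∑-mono g f (λ i → ℕ.≮⇒≥ (¬∃i ∘ (i ,_)))) (ℕ.<⇒≱ ∑f<∑g)

term≤∑ : (f : Fin n → ℕ) (i : Fin n) → f i ≤ sum f
term≤∑ f zero    = ℕ.m≤m+n _ _
term≤∑ f (suc i) = ℕ.≤-trans (term≤∑ (f ∘ suc) i) (ℕ.m≤n+m _ _)

∑𝟙-empty : {P : Pred (Fin n) 0ℓ} (P? : Decidable P) → (∀ i → ¬ P i) → sum (𝟙 ∘ P?) ≡ 0
∑𝟙-empty {zero}  P? ¬P = refl
∑𝟙-empty {suc n} P? ¬P = cong₂ _+_ (𝟙-no (P? zero) (¬P zero)) (∑𝟙-empty (P? ∘ suc) (¬P ∘ suc))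

∑𝟙-unique : {P : Pred (Fin n) 0ℓ} (P? : Decidable P) → (∀ {i j} → P i → P j → i ≡ j) →
            sum (𝟙 ∘ P?) ≤ 1
∑𝟙-unique {zero}  P? uniq = z≤n
∑𝟙-unique {suc n} P? uniq with P? zero
... | yes p₀ = ℕ.≤-reflexive (cong suc (∑𝟙-empty (P? ∘ suc) (λ i p → contradiction (uniq p₀ p) λ ())))
... | no _   = ∑𝟙-unique (P? ∘ suc) (λ p q → Fin.suc-injective (uniq p q))

∑-singleton : (x : Fin n) → sum (λ i → 𝟙 (i ≟ x)) ≡ 1
∑-singleton x = ℕ.≤-antisym
  (∑𝟙-unique (_≟ x) (λ i≡x j≡x → trans i≡x (sym j≡x)))
  (ℕ.≤-trans (ℕ.≤-reflexive (sym (𝟙-yes (x ≟ x) refl))) (term≤∑ (λ i → 𝟙 (i ≟ x)) x))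

-- Double counting of the pairs `i`, `x` with `x ≡ g i`: every `i` has exactly one such `x`, every
-- `x` in `P` at most one such `i`, and every other `x` none.
≤∑𝟙-injection : ∀ {c} {P : Pred (Fin n) 0ℓ} (P? : Decidable P) (g : Fin c → Fin n) →
                (∀ i → P (g i)) → (∀ {i j} → g i ≡ g j → i ≡ j) → c ≤ sum (𝟙 ∘ P?)
≤∑𝟙-injection {n} {c} P? g Pg g-inj = begin
  c                                         ≡⟨ ∑1 c ⟨
  sum {c} (λ i → 1)                         ≡⟨ sum-cong-≗ (λ i → sym (∑-singleton (g i))) ⟩
  sum (λ i → sum (λ x → 𝟙 (x ≟ g i)))       ≡⟨ ∑-comm (λ i x → 𝟙 (x ≟ g i)) ⟩
  sum (λ x → sum (λ i → 𝟙 (x ≟ g i)))       ≤⟨ ∑-mono _ _ fibre ⟩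
  sum (𝟙 ∘ P?)                              ∎
  where
  open ℕ.≤-Reasoning
  ∑1 : ∀ m → sum {m} (λ i → 1) ≡ m
  ∑1 zero    = refl
  ∑1 (suc m) = cong suc (∑1 m)

  fibre : ∀ x → sum (λ i → 𝟙 (x ≟ g i)) ≤ 𝟙 (P? x)
  fibre x with P? x
  ... | yes _  = ∑𝟙-unique (λ i → x ≟ g i) (λ x≡gi x≡gj → g-inj (trans (sym x≡gi) x≡gj))
  ... | no ¬Px = ℕ.≤-reflexive (∑𝟙-empty (λ i → x ≟ g i) (λ { i refl → ¬Px (Pg i) }))

-- Cardinalities of subsets

∣comprehension∣ : {P : Pred (Fin n) 0ℓ} (P? : Decidable P) → ∣ comprehension P? ∣ ≡ sum (𝟙 ∘ P?)
∣comprehension∣ {zero}  P? = refl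
∣comprehension∣ {suc n} P? with does (P? zero)
... | true  = cong suc (∣comprehension∣ (P? ∘ suc))
... | false = ∣comprehension∣ (P? ∘ suc)

∣p∣≡∑ : (p : Subset n) → ∣ p ∣ ≡ sum (λ i → 𝟙 (i ∈? p))
∣p∣≡∑ []            = refl
∣p∣≡∑ (inside ∷ p)  = cong suc (∣p∣≡∑ p)
∣p∣≡∑ (outside ∷ p) = ∣p∣≡∑ p

∈-comprehension⁺ : {P : Pred (Fin n) 0ℓ} (P? : Decidable P) {i : Fin n} → P i → i ∈ comprehension P?
∈-comprehension⁺ P? {i} p = lookup⇒[]= i _ (trans (lookup∘tabulate _ i) (dec-true (P? i) p))

∈-comprehension⁻ : {P : Pred (Fin n) 0ℓ} (P? : Decidable P) {i : Fin n} → i ∈ comprehension P? → P i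
∈-comprehension⁻ P? {i} i∈ with P? i | trans (sym (lookup∘tabulate (does ∘ P?) i)) ([]=⇒lookup i∈)
... | yes p | _ = p

-- `IsSeparator` prescribes an exact size, so a smaller separating set `p` has to be filled up; the
-- upper bound `q` keeps the vertices to be separated out of the filling.
∃-between : (p q : Subset n) → p ⊆ q → ∀ m → ∣ p ∣ ≤ m → m ≤ ∣ q ∣ →
            ∃ λ r → p ⊆ r × r ⊆ q × ∣ r ∣ ≡ m
∃-between [] [] _ _ _ z≤n = [] , id , id , refl
∃-between (outside ∷ p) (outside ∷ q) p⊆q m lo hi
  with r , p⊆r , r⊆q , eq ← ∃-between p q (drop-∷-⊆ p⊆q) m lo hi =
  outside ∷ r , s⊆s p⊆r , s⊆s r⊆q , eq
∃-between (inside ∷ p) (outside ∷ q) p⊆q m lo hi with () ← p⊆q here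
∃-between (inside ∷ p) (inside ∷ q) p⊆q (suc m) (s≤s lo) (s≤s hi)
  with r , p⊆r , r⊆q , eq ← ∃-between p q (drop-∷-⊆ p⊆q) m lo hi =
  inside ∷ r , s⊆s p⊆r , s⊆s r⊆q , cong suc eq
∃-between (outside ∷ p) (inside ∷ q) p⊆q m lo hi with m ℕ.≤? ∣ q ∣
... | yes m≤q
  with r , p⊆r , r⊆q , eq ← ∃-between p q (drop-∷-⊆ p⊆q) m lo m≤q =
  outside ∷ r , s⊆s p⊆r , out⊆ r⊆q , eq
... | no m≰q = inside ∷ q , out⊆ (drop-∷-⊆ p⊆q) , id , ℕ.≤-antisym (ℕ.≰⇒> m≰q) hi

-- Graphs with weights decreasing along walks

-- `H` picks exactly one direction of every related pair, so `H` and its transpose each account for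
-- half of `R`. It serves for `Heavy` and for the order on `Fin N`.
∑∑-orientation : {R H : Rel (Fin n) 0ℓ} (R? : B.Decidable R) (H? : B.Decidable H) →
                 (∀ {u v} → R u v → H u v ⊎ H v u) →
                 (∀ {u v} → H u v → R u v) → (∀ {u v} → H u v → R v u) →
                 (∀ {u v} → H u v → ¬ H v u) →
                 sum (λ u → sum (λ v → 𝟙 (R? u v))) ≡ 2 * sum (λ u → sum (λ v → 𝟙 (H? u v)))
∑∑-orientation R? H? split H⇒R H⇒R˘ asym = begin
  sum (λ u → sum (λ v → 𝟙 (R? u v)))
    ≡⟨ sum-cong-≗ (λ u → trans
         (sum-cong-≗ (λ v → 𝟙-split (R? u v) (H? u v) (H? v u) split H⇒R H⇒R˘ asym))
         (∑-distrib-+ (λ v → 𝟙 (H? u v)) (λ v → 𝟙 (H? v u)))) ⟩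
  sum (λ u → sum (λ v → 𝟙 (H? u v)) + sum (λ v → 𝟙 (H? v u)))
    ≡⟨ ∑-distrib-+ (λ u → sum (λ v → 𝟙 (H? u v))) (λ u → sum (λ v → 𝟙 (H? v u))) ⟩
  h + sum (λ u → sum (λ v → 𝟙 (H? v u)))
    ≡⟨ cong (λ i → h + i) (∑-comm (λ u v → 𝟙 (H? v u))) ⟩
  h + h
    ≡⟨ cong (λ i → h + i) (ℕ.+-identityʳ h) ⟨
  2 * h ∎
  where
  open ≡-Reasoning
  h = sum (λ u → sum (λ v → 𝟙 (H? u v)))

module _ (F : Graph N) (w : Fin N → Fin N → ℕ) where
  open Graph F

  module _ (w-decreasing : ∀ {y x z} → y ~ x → x ~ z → y ≢ z → w x z < w y x) where

    -- Ties between the two weights of an edge are broken by the order on `Fin N`, so that exactly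
    -- one direction of each edge is heavy.
    Heavy : Rel (Fin N) 0ℓ
    Heavy u v = u ~ v × (w v u < w u v ⊎ (w v u ≡ w u v × u Fin.< v))

    Heavy? : B.Decidable Heavy
    Heavy? u v = (u ~? v) ×-dec
      ((w v u ℕ.<? w u v) ⊎-dec ((w v u ℕ.≟ w u v) ×-dec (u <? v)))

    heavy⇒≥ : ∀ {u v} → Heavy u v → w v u ≤ w u v
    heavy⇒≥ (_ , inj₁ lt)       = ℕ.<⇒≤ lt
    heavy⇒≥ (_ , inj₂ (eq , _)) = ℕ.≤-reflexive eq

    heavy-total : ∀ {u v} → u ~ v → Heavy u v ⊎ Heavy v u
    heavy-total {u} {v} u~v with ℕ.<-cmp (w v u) (w u v)
    ... | tri< lt _ _ = inj₁ (u~v , inj₁ lt)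
    ... | tri> _ _ gt = inj₂ (~-sym u~v , inj₁ gt)
    ... | tri≈ _ eq _ with <-cmp u v
    ...   | tri< u<v _ _ = inj₁ (u~v , inj₂ (eq , u<v))
    ...   | tri≈ _ u≡v _ = contradiction u~v (~-irrefl u≡v)
    ...   | tri> _ _ v<u = inj₂ (~-sym u~v , inj₂ (sym eq , v<u))

    heavy-asym : ∀ {u v} → Heavy u v → ¬ Heavy v u
    heavy-asym (_ , inj₁ lt)        vu = ℕ.<⇒≱ lt (heavy⇒≥ vu)
    heavy-asym (_ , inj₂ (eq , _))  (_ , inj₁ gt) = ℕ.<-irrefl (sym eq) gt
    heavy-asym (_ , inj₂ (_ , u<v)) (_ , inj₂ (_ , v<u)) = Fin.<-asym u<v v<u

    -- Two heavy edges x → y, x → z would give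
    -- w y x ≤ w x y < w z x ≤ w x z < w y x.
    heavy-unique : ∀ {x y z} → Heavy x y → Heavy x z → y ≡ z
    heavy-unique {x} {y} {z} xy xz with y ≟ z
    ... | yes y≡z = y≡z
    ... | no y≢z = contradiction cycle (ℕ.<-irrefl refl)
      where
      cycle : w y x < w y x
      cycle = ℕ.≤-<-trans (heavy⇒≥ xy)
        (ℕ.<-trans (ℕ.<-≤-trans (w-decreasing (~-sym (proj₁ xz)) (proj₁ xy) (y≢z ∘ sym)) (heavy⇒≥ xz))
                   (w-decreasing (~-sym (proj₁ xy)) (proj₁ xz) y≢z))

    Sink : Pred (Fin N) 0ℓ
    Sink v = v ∈ V × ¬ ∃ (Heavy v)

    Sink? : Decidable Sink
    Sink? v = (v ∈? V) ×-dec ¬? (any? (Heavy? v))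

    heavy⇒sink : ∀ {u v} → Heavy u v → Acc _<_ (w u v) → ∃ λ s → Sink s × Reachable F v s
    heavy⇒sink {u} {v} uv (acc rs) with any? (Heavy? v)
    ... | no ¬vz = v , (~⇒∈V (~-sym (proj₁ uv)) , ¬vz) , ε
    ... | yes (z , vz)
      -- The walk cannot turn back to `u`, because `Heavy` is asymmetric; hence the weight drops and
      -- the recursion is well-founded.
      with s , s-sink , z⇝s ← heavy⇒sink vz
             (rs (w-decreasing (proj₁ uv) (proj₁ vz) (λ { refl → heavy-asym uv vz })))
      = s , s-sink , proj₁ vz ◅ z⇝s

    sink-reachable : ∀ {v} → v ∈ V → ∃ λ s → Sink s × Reachable F v s
    sink-reachable {v} v∈V with any? (Heavy? v)
    ... | no ¬vz = v , (v∈V , ¬vz) , ε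
    ... | yes (z , vz) with s , s-sink , z⇝s ← heavy⇒sink vz (<-wellFounded _)
      = s , s-sink , proj₁ vz ◅ z⇝s

    -- Each component is assigned a sink reachable from its representative; two components with the
    -- same sink would have mutually reachable representatives.
    c≤∑Sink : ∀ {c} → HasComponentCount F c → c ≤ sum (𝟙 ∘ Sink?)
    c≤∑Sink {c} count = ≤∑𝟙-injection Sink? sink sink-Sink sink-injective
      where
      open Bijection count
      rep : Fin c → ∃ (_∈ V)
      rep i = proj₁ (surjective i)

      rep-to : ∀ i → to (rep i) ≡ i
      rep-to i = proj₂ (surjective i) ε

      sink : Fin c → Fin N
      sink i = proj₁ (sink-reachable (proj₂ (rep i)))

      sink-Sink : ∀ i → Sink (sink i)
      sink-Sink i = proj₁ (proj₂ (sink-reachable (proj₂ (rep i))))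

      rep⇝sink : ∀ i → Reachable F (proj₁ (rep i)) (sink i)
      rep⇝sink i = proj₂ (proj₂ (sink-reachable (proj₂ (rep i))))

      sink-injective : ∀ {i j} → sink i ≡ sink j → i ≡ j
      sink-injective {i} {j} eq = trans (sym (rep-to i)) (trans (Bijection.cong count
        (rep⇝sink i ◅◅ subst (λ s → Reachable F s _) (sym eq) (reverse ~-sym (rep⇝sink j)))) (rep-to j))

    -- A sink has no outgoing heavy edge, any other vertex at most one by `heavy-unique`, and an
    -- index outside `V` none. The decisions are arguments so that matching on them evaluates the
    -- indicators.
    outdegree+sink : ∀ {x} (s? : Dec (Sink x)) (x∈V? : Dec (x ∈ V)) →
                     sum (λ z → 𝟙 (Heavy? x z)) + 𝟙 s? ≤ 𝟙 x∈V?
    outdegree+sink {x} (yes (_ , ¬xz)) (yes _)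
      rewrite ∑𝟙-empty (Heavy? x) (λ z xz → ¬xz (z , xz)) = ℕ.≤-refl
    outdegree+sink (yes (x∈V , _)) (no x∉V) = contradiction x∈V x∉V
    outdegree+sink {x} (no _) (yes _)
      rewrite ℕ.+-identityʳ (sum (λ z → 𝟙 (Heavy? x z))) = ∑𝟙-unique (Heavy? x) heavy-unique
    outdegree+sink {x} (no _) (no x∉V)
      rewrite ∑𝟙-empty (Heavy? x) (λ z xz → x∉V (~⇒∈V (proj₁ xz))) = z≤n

    -- The forest bound, doubled because the left side counts each edge from both ends: `h` is the
    -- number of edges, and each vertex pays for at most one outgoing edge or for being a sink.
    degreeSum+2c≤2order : ∀ {c} → HasComponentCount F c →
      sum (λ u → sum (λ v → 𝟙 (u ~? v))) + 2 * c ≤ 2 * order F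
    degreeSum+2c≤2order {c} count = begin
      sum (λ u → sum (λ v → 𝟙 (u ~? v))) + 2 * c
        ≡⟨ cong (_+ 2 * c) (∑∑-orientation {H = Heavy} _~?_ Heavy? heavy-total proj₁ (~-sym ∘ proj₁) heavy-asym) ⟩
      2 * h + 2 * c
        ≡⟨ ℕ.*-distribˡ-+ 2 h c ⟨
      2 * (h + c)
        ≤⟨ ℕ.*-monoʳ-≤ 2 (ℕ.+-monoʳ-≤ h (c≤∑Sink count)) ⟩
      2 * (h + sum (𝟙 ∘ Sink?))
        ≡⟨ cong (2 *_) (∑-distrib-+ (λ u → sum (λ v → 𝟙 (Heavy? u v))) (𝟙 ∘ Sink?)) ⟨
      2 * sum (λ u → sum (λ v → 𝟙 (Heavy? u v)) + 𝟙 (Sink? u))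
        ≤⟨ ℕ.*-monoʳ-≤ 2 (∑-mono _ _ (λ x → outdegree+sink (Sink? x) (x ∈? V))) ⟩
      2 * sum (λ u → 𝟙 (u ∈? V))
        ≡⟨ cong (2 *_) (∣p∣≡∑ V) ⟨
      2 * order F ∎
      where
      open ℕ.≤-Reasoning
      h = sum (λ u → sum (λ v → 𝟙 (Heavy? u v)))

-- Separators and cuts

module _ (G : Graph N) (kconn : IsConnected (suc m) G) where
  open Graph G

  -- A walk that starts in `D` can leave it only through `S`. Filled up to exactly `m` vertices
  -- other than `d` and `w`, `S` would separate `d` from `w`, which connectivity forbids.
  no-small-separation : {D S : Pred (Fin N) 0ℓ} (S? : Decidable S) →
    (∀ {v} → S v → v ∈ V) → sum (𝟙 ∘ S?) ≤ m →
    (∀ {p q} → D p → p ~ q → D q ⊎ S q) →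
    ∀ {d w} → d ∈ V → D d → ¬ S d → w ∈ V → ¬ D w → ¬ S w → ⊥
  no-small-separation {D} {S} S? S⊆V ∣S∣≤m closed {d} {w} d∈V Dd ¬Sd w∈V ¬Dw ¬Sw =
    let R , S⊆R , R⊆Q , ∣R∣≡m = ∃-between (comprehension S?) (comprehension Q?) S⊆Q m
          (ℕ.≤-trans (ℕ.≤-reflexive (∣comprehension∣ S?)) ∣S∣≤m) m≤∣Q∣
        R⇒Q : ∀ {v} → v ∈ R → v ∈ V × v ≢ d × v ≢ w
        R⇒Q v∈R = ∈-comprehension⁻ Q? (R⊆Q v∈R)
    in proj₂ kconn (R , proj₁ ∘ R⇒Q , ∣R∣≡m , λ conn →
         ¬Dw (D-star S⊆R Dd (conn
           (x∈p∧x∉q⇒x∈p─q d∈V (λ d∈R → proj₁ (proj₂ (R⇒Q d∈R)) refl))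
           (x∈p∧x∉q⇒x∈p─q w∈V (λ w∈R → proj₂ (proj₂ (R⇒Q w∈R)) refl)))))
    where
    Q? : Decidable (λ v → v ∈ V × v ≢ d × v ≢ w)
    Q? v = (v ∈? V) ×-dec (¬? (v ≟ d) ×-dec ¬? (v ≟ w))

    S⊆Q : comprehension S? ⊆ comprehension Q?
    S⊆Q {v} v∈S = ∈-comprehension⁺ Q? (S⊆V Sv , (λ { refl → ¬Sd Sv }) , (λ { refl → ¬Sw Sv }))
      where Sv = ∈-comprehension⁻ S? v∈S

    V⊆Q∪dw : ∀ v → v ∈ V → (v ∈ V × v ≢ d × v ≢ w) ⊎ (v ≡ d ⊎ v ≡ w)
    V⊆Q∪dw v v∈V with v ≟ d | v ≟ w
    ... | yes v≡d | _       = inj₂ (inj₁ v≡d)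
    ... | no _    | yes v≡w = inj₂ (inj₂ v≡w)
    ... | no v≢d  | no v≢w  = inj₁ (v∈V , v≢d , v≢w)

    -- Room for the filling: the order is at least `m + 2`, and only `d` and `w` are excluded.
    m≤∣Q∣ : m ≤ ∣ comprehension Q? ∣
    m≤∣Q∣ = ℕ.+-cancelʳ-≤ 2 m _ (begin
      m + 2                                        ≡⟨ ℕ.+-comm m 2 ⟩
      2 + m                                        ≤⟨ proj₁ kconn ⟩
      ∣ V ∣                                        ≡⟨ ∣p∣≡∑ V ⟩
      sum (λ v → 𝟙 (v ∈? V))
        ≤⟨ ∑-mono _ _ (λ v → ℕ.≤-trans
             (𝟙-mono (v ∈? V) (Q? v ⊎-dec ((v ≟ d) ⊎-dec (v ≟ w))) (V⊆Q∪dw v))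
             (ℕ.≤-trans (𝟙-⊎ (Q? v) ((v ≟ d) ⊎-dec (v ≟ w)))
               (ℕ.+-monoʳ-≤ (𝟙 (Q? v)) (𝟙-⊎ (v ≟ d) (v ≟ w))))) ⟩
      sum (λ v → 𝟙 (Q? v) + (𝟙 (v ≟ d) + 𝟙 (v ≟ w)))
        ≡⟨ ∑-distrib-+ (𝟙 ∘ Q?) (λ v → 𝟙 (v ≟ d) + 𝟙 (v ≟ w)) ⟩
      sum (𝟙 ∘ Q?) + sum (λ v → 𝟙 (v ≟ d) + 𝟙 (v ≟ w))
        ≡⟨ cong (λ i → sum (𝟙 ∘ Q?) + i) (trans (∑-distrib-+ (λ v → 𝟙 (v ≟ d)) (λ v → 𝟙 (v ≟ w)))
             (cong₂ _+_ (∑-singleton d) (∑-singleton w))) ⟩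
      sum (𝟙 ∘ Q?) + 2                             ≡⟨ cong (_+ 2) (∣comprehension∣ Q?) ⟨
      ∣ comprehension Q? ∣ + 2                     ∎)
      where open ℕ.≤-Reasoning

    D-star : ∀ {R} → comprehension S? ⊆ R → ∀ {p q} → D p → Reachable (deleteVertices G R) p q → D q
    D-star S⊆R Dp ε = Dp
    D-star S⊆R Dp ((p~r , _ , r∉R) ◅ r⇝q) with closed Dp p~r
    ... | inj₁ Dr = D-star S⊆R Dr r⇝q
    ... | inj₂ Sr = contradiction (S⊆R (∈-comprehension⁺ S? Sr)) r∉R

  -- With at most `m` neighbours, `v` and its neighbours would not exhaust the more than `m + 1`
  -- vertices, and the neighbourhood would separate `v` from a remaining vertex.
  minDegree : ∀ {v} → v ∈ V → suc m ≤ degree G v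
  minDegree {v} v∈V = ℕ.≮⇒≥ λ { (s≤s d≤m) →
    small-degree (ℕ.≤-trans (ℕ.≤-reflexive (sym (∣comprehension∣ (v ~?_)))) d≤m) }
    where
    module _ (d≤m : sum (λ u → 𝟙 (v ~? u)) ≤ m) where
      small : sum (λ u → 𝟙 (u ≟ v) + 𝟙 (v ~? u)) < sum (λ u → 𝟙 (u ∈? V))
      small = begin-strict
        sum (λ u → 𝟙 (u ≟ v) + 𝟙 (v ~? u))
          ≡⟨ ∑-distrib-+ (λ u → 𝟙 (u ≟ v)) (λ u → 𝟙 (v ~? u)) ⟩
        sum (λ u → 𝟙 (u ≟ v)) + sum (λ u → 𝟙 (v ~? u))
          ≡⟨ cong (_+ sum (λ u → 𝟙 (v ~? u))) (∑-singleton v) ⟩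
        1 + sum (λ u → 𝟙 (v ~? u))  ≤⟨ s≤s d≤m ⟩
        suc m                       <⟨ proj₁ kconn ⟩
        ∣ V ∣                       ≡⟨ ∣p∣≡∑ V ⟩
        sum (λ u → 𝟙 (u ∈? V))      ∎
        where open ℕ.≤-Reasoning

      small-degree : ⊥
      small-degree
        with u , lt ← ∑<∑⇒∃< (λ u → 𝟙 (u ≟ v) + 𝟙 (v ~? u)) (λ u → 𝟙 (u ∈? V)) small
        with u∈V , none ← <𝟙⇒ (u ∈? V) lt
        = no-small-separation {D = _≡ v} (v ~?_) (~⇒∈V ∘ ~-sym) d≤m (λ { refl v~q → inj₂ v~q })
            v∈V refl (~-irrefl refl)
            u∈V (𝟙≡0⇒¬ (u ≟ v) (ℕ.m+n≡0⇒m≡0 _ none)) (𝟙≡0⇒¬ (v ~? u) (ℕ.m+n≡0⇒n≡0 (𝟙 (u ≟ v)) none))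

-- Uncrossing two cuts

data Side : Set where
  near cut far out : Side

isCut isFar : Side → Bool
isCut cut = true
isCut _   = false
isFar far = true
isFar _   = false

-- With v on side s of one cut and side t of another, corner s t says that v lies
-- in the boundary of the intersection of the first far and the second near side.
corner : Side → Side → Bool
corner far cut  = true
corner cut near = true
corner cut cut  = true
corner _   _    = false

-- Submodularity of the vertex boundary, one vertex at a time: a vertex in the boundaries of both
-- opposite corners lies in both cuts, and a vertex in one of them lies in at least one cut.
corner-submodular : ∀ s t → ⟦ corner s t ⟧ + ⟦ corner t s ⟧ ≤ ⟦ isCut s ⟧ + ⟦ isCut t ⟧
corner-submodular near near = z≤n
corner-submodular near cut  = ℕ.≤-refl
corner-submodular near far  = z≤n
corner-submodular near out  = z≤n
corner-submodular cut  near = ℕ.≤-refl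
corner-submodular cut  cut  = ℕ.≤-refl
corner-submodular cut  far  = ℕ.≤-refl
corner-submodular cut  out  = z≤n
corner-submodular far  near = z≤n
corner-submodular far  cut  = ℕ.≤-refl
corner-submodular far  far  = z≤n
corner-submodular far  out  = z≤n
corner-submodular out  near = z≤n
corner-submodular out  cut  = z≤n
corner-submodular out  far  = z≤n
corner-submodular out  out  = z≤n

-- The two terms on the left exclude each other, since no boundary vertex is far for `t`. The
-- hypotheses leave only far and cut for `s` when `t` is far.
far+corner≤far+cut : ∀ s t → (s ≡ near → t ≢ far) → (s ≡ out → t ≢ far) →
                     ⟦ isFar t ⟧ + ⟦ corner s t ⟧ ≤ ⟦ isFar s ⟧ + ⟦ isCut s ⟧
far+corner≤far+cut near near _ _ = z≤n
far+corner≤far+cut near cut  _ _ = z≤n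
far+corner≤far+cut near far  h _ = contradiction refl (h refl)
far+corner≤far+cut near out  _ _ = z≤n
far+corner≤far+cut cut  near _ _ = ℕ.≤-refl
far+corner≤far+cut cut  cut  _ _ = ℕ.≤-refl
far+corner≤far+cut cut  far  _ _ = ℕ.≤-refl
far+corner≤far+cut cut  out  _ _ = z≤n
far+corner≤far+cut far  near _ _ = z≤n
far+corner≤far+cut far  cut  _ _ = ℕ.≤-refl
far+corner≤far+cut far  far  _ _ = ℕ.≤-refl
far+corner≤far+cut far  out  _ _ = z≤n
far+corner≤far+cut out  near _ _ = z≤n
far+corner≤far+cut out  cut  _ _ = z≤n
far+corner≤far+cut out  far  _ h = contradiction refl (h refl)
far+corner≤far+cut out  out  _ _ = z≤n

-- A separation of `G - ab` with `m` separating vertices, stated in `G` with the edge `ab` as the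
-- only one allowed between `near` and `far`. The value `out` marks the elements of `Fin N` that are
-- not vertices.
record IsCutOf (G : Graph N) (m : ℕ) (a b : Fin N) (side : Fin N → Side) : Set where
  open Graph G
  field
    near-end : side a ≡ near
    far-end  : side b ≡ far
    near-nbr : ∀ {p q} → side p ≡ near → p ~ q → side q ≡ near ⊎ side q ≡ cut ⊎ (p ≡ a × q ≡ b)
    far-nbr  : ∀ {p q} → side p ≡ far → p ~ q → side q ≡ far ⊎ side q ≡ cut ⊎ (p ≡ b × q ≡ a)
    out⇒∉V   : ∀ {p} → side p ≡ out → p ∉ V
    ¬out⇒∈V  : ∀ {p} → side p ≢ out → p ∈ V
    size     : sum (λ v → ⟦ isCut (side v) ⟧) ≡ m

∣far∣ : (Fin N → Side) → ℕ
∣far∣ s = sum (λ v → ⟦ isFar (s v) ⟧)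

module _ {G : Graph N} {a b c d : Fin N} {s t : Fin N → Side}
         (C : IsCutOf G m a b s) (D : IsCutOf G m c d t) where
  open Graph G
  private
    module C = IsCutOf C
    module D = IsCutOf D

  -- An edge leaving the intersection leaves one of the two sides, so it ends in the boundary
  -- `corner` unless it is the exceptional edge of one of the cuts.
  far∩near-nbr : ∀ {p q} → s p ≡ far → t p ≡ near → p ~ q →
    (s q ≡ far × t q ≡ near) ⊎ T (corner (s q) (t q)) ⊎ ((p ≡ b × q ≡ a) ⊎ (p ≡ c × q ≡ d))
  far∩near-nbr {p} {q} p-far p-near p~q with C.far-nbr p-far p~q | D.near-nbr p-near p~q
  ... | inj₂ (inj₂ ba)  | _              = inj₂ (inj₂ (inj₁ ba))
  ... | inj₁ _          | inj₂ (inj₂ cd) = inj₂ (inj₂ (inj₂ cd))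
  ... | inj₂ (inj₁ _)   | inj₂ (inj₂ cd) = inj₂ (inj₂ (inj₂ cd))
  ... | inj₁ q-far      | inj₁ q-near    = inj₁ (q-far , q-near)
  ... | inj₁ q-far      | inj₂ (inj₁ q-cut) rewrite q-far | q-cut = inj₂ (inj₁ _)
  ... | inj₂ (inj₁ q-cut) | inj₁ q-near rewrite q-near | q-cut = inj₂ (inj₁ _)
  ... | inj₂ (inj₁ q-cut) | inj₂ (inj₁ q-cut′) rewrite q-cut | q-cut′ = inj₂ (inj₁ _)

  corner⇒∈V : ∀ {p} → T (corner (s p) (t p)) → p ∈ V
  corner⇒∈V {p} corn = C.¬out⇒∈V (λ p-out → subst (λ u → T (corner u (t p))) p-out corn)

  ∣corner∣+∣corner∣≤2m : sum (λ v → ⟦ corner (s v) (t v) ⟧) + sum (λ v → ⟦ corner (t v) (s v) ⟧) ≤ m + m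
  ∣corner∣+∣corner∣≤2m = begin
    sum (λ v → ⟦ corner (s v) (t v) ⟧) + sum (λ v → ⟦ corner (t v) (s v) ⟧)
      ≡⟨ ∑-distrib-+ (λ v → ⟦ corner (s v) (t v) ⟧) (λ v → ⟦ corner (t v) (s v) ⟧) ⟨
    sum (λ v → ⟦ corner (s v) (t v) ⟧ + ⟦ corner (t v) (s v) ⟧)
      ≤⟨ ∑-mono _ _ (λ v → corner-submodular (s v) (t v)) ⟩
    sum (λ v → ⟦ isCut (s v) ⟧ + ⟦ isCut (t v) ⟧)
      ≡⟨ ∑-distrib-+ (λ v → ⟦ isCut (s v) ⟧) (λ v → ⟦ isCut (t v) ⟧) ⟩
    sum (λ v → ⟦ isCut (s v) ⟧) + sum (λ v → ⟦ isCut (t v) ⟧)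
      ≡⟨ cong₂ _+_ C.size D.size ⟩
    m + m ∎
    where open ℕ.≤-Reasoning

module _ {G : Graph N} (kconn : IsConnected (suc m) G) {y x z : Fin N} {s t : Fin N → Side}
         (C : IsCutOf G m y x s) (D : IsCutOf G m x z t) where
  open Graph G
  private
    module C = IsCutOf C
    module D = IsCutOf D

    ∣corner∣ : ℕ
    ∣corner∣ = sum (λ v → ⟦ corner (s v) (t v) ⟧)

    ¬corner-near : ∀ {p} → s p ≡ near → ¬ T (corner (s p) (t p))
    ¬corner-near p-near rewrite p-near = λ ()

    y≢x : y ≢ x
    y≢x refl with () ← trans (sym C.near-end) C.far-end

  module _ (y~x : y ~ x) (x~z : x ~ z) (y≢z : y ≢ z) (m+1<deg : suc m < degree G x) where

    -- Otherwise x has a neighbour v ≠ x in far ∩ near, and the corner together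
    -- with x separates v from y.
    m≤∣corner∣ : m ≤ ∣corner∣
    m≤∣corner∣ = ℕ.≮⇒≥ small-corner
      where
      module _ (c<m : ∣corner∣ < m) where
        -- At most `m - 1` corner vertices together with `y` and `z` cannot cover the more than
        -- `m + 1` neighbours of `x`.
        few : sum (λ v → ⟦ corner (s v) (t v) ⟧ + (𝟙 (v ≟ y) + 𝟙 (v ≟ z))) < sum (λ v → 𝟙 (x ~? v))
        few = begin-strict
          sum (λ v → ⟦ corner (s v) (t v) ⟧ + (𝟙 (v ≟ y) + 𝟙 (v ≟ z)))
            ≡⟨ ∑-distrib-+ (λ v → ⟦ corner (s v) (t v) ⟧) (λ v → 𝟙 (v ≟ y) + 𝟙 (v ≟ z)) ⟩
          ∣corner∣ + sum (λ v → 𝟙 (v ≟ y) + 𝟙 (v ≟ z))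
            ≡⟨ cong (λ i → ∣corner∣ + i) (trans (∑-distrib-+ (λ v → 𝟙 (v ≟ y)) (λ v → 𝟙 (v ≟ z)))
                 (cong₂ _+_ (∑-singleton y) (∑-singleton z))) ⟩
          ∣corner∣ + 2            ≡⟨ ℕ.+-comm ∣corner∣ 2 ⟩
          2 + ∣corner∣            ≤⟨ s≤s c<m ⟩
          suc m                   <⟨ m+1<deg ⟩
          degree G x              ≡⟨ ∣comprehension∣ (x ~?_) ⟩
          sum (λ v → 𝟙 (x ~? v))  ∎
          where open ℕ.≤-Reasoning

        -- Both exceptional edges start at `x`, so putting `x` into the separator disposes of them;
        -- the size stays within `m` because the corner has fewer than `m` vertices.
        S? : Decidable (λ p → T (corner (s p) (t p)) ⊎ p ≡ x)
        S? p = T? (corner (s p) (t p)) ⊎-dec (p ≟ x)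

        ∣S∣≤m : sum (𝟙 ∘ S?) ≤ m
        ∣S∣≤m = begin
          sum (𝟙 ∘ S?)  ≤⟨ ∑-mono _ _ (λ p → 𝟙-⊎ (T? (corner (s p) (t p))) (p ≟ x)) ⟩
          sum (λ p → ⟦ corner (s p) (t p) ⟧ + 𝟙 (p ≟ x))
            ≡⟨ ∑-distrib-+ (λ p → ⟦ corner (s p) (t p) ⟧) (λ p → 𝟙 (p ≟ x)) ⟩
          ∣corner∣ + sum (λ p → 𝟙 (p ≟ x))  ≡⟨ cong (λ i → ∣corner∣ + i) (∑-singleton x) ⟩
          ∣corner∣ + 1                      ≡⟨ ℕ.+-comm ∣corner∣ 1 ⟩
          suc ∣corner∣                      ≤⟨ c<m ⟩
          m ∎
          where open ℕ.≤-Reasoning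

        closed : ∀ {p q} → (s p ≡ far × t p ≡ near) × p ≢ x → p ~ q →
                 ((s q ≡ far × t q ≡ near) × q ≢ x) ⊎ (T (corner (s q) (t q)) ⊎ q ≡ x)
        closed {q = q} ((p-far , p-near) , p≢x) p~q with q ≟ x | far∩near-nbr C D p-far p-near p~q
        ... | yes q≡x | _                             = inj₂ (inj₂ q≡x)
        ... | no q≢x  | inj₁ q-in                     = inj₁ (q-in , q≢x)
        ... | no _    | inj₂ (inj₁ corn)              = inj₂ (inj₁ corn)
        ... | no _    | inj₂ (inj₂ (inj₁ (p≡x , _)))  = contradiction p≡x p≢x
        ... | no _    | inj₂ (inj₂ (inj₂ (p≡x , _)))  = contradiction p≡x p≢x

        no-inner-nbr : ∀ {v} → x ~ v → ¬ (s v ≡ far × t v ≡ near)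
        no-inner-nbr {v} x~v (v-far , v-near) = no-small-separation G kconn S?
          [ corner⇒∈V C D , (λ { refl → ~⇒∈V x~z }) ]′ ∣S∣≤m closed
          (~⇒∈V (~-sym x~v)) ((v-far , v-near) , v≢x)
          [ (λ corn → subst T (cong₂ corner v-far v-near) corn) , v≢x ]′
          (~⇒∈V y~x) (λ { ((y-far , _) , _) → contradiction (trans (sym C.near-end) y-far) λ () })
          [ ¬corner-near C.near-end , y≢x ]′
          where
          v≢x : v ≢ x
          v≢x refl = ~-irrefl refl x~v

        small-corner : ⊥
        small-corner
          -- `v` is a neighbour of `x` outside the corner and different from `y` and `z`. As `x` is
          -- far for `s` and near for `t`, only the intersection remains for `v`.
          with v , lt ← ∑<∑⇒∃< _ _ few
          with x~v , none ← <𝟙⇒ (x ~? v) lt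
          with none′ ← ℕ.m+n≡0⇒n≡0 ⟦ corner (s v) (t v) ⟧ none
          with far∩near-nbr C D C.far-end D.near-end x~v
        ... | inj₁ v-in = no-inner-nbr x~v v-in
        ... | inj₂ (inj₁ corn) =
          𝟙≡0⇒¬ (T? (corner (s v) (t v))) (ℕ.m+n≡0⇒m≡0 _ none) corn
        ... | inj₂ (inj₂ (inj₁ (_ , v≡y))) = 𝟙≡0⇒¬ (v ≟ y) (ℕ.m+n≡0⇒m≡0 _ none′) v≡y
        ... | inj₂ (inj₂ (inj₂ (_ , v≡z))) = 𝟙≡0⇒¬ (v ≟ z) (ℕ.m+n≡0⇒n≡0 (𝟙 (v ≟ y)) none′) v≡z

    -- Together with `z-side` this keeps the exceptional edges away from the opposite intersection:
    -- `y` and `z` are neighbours of `x`, joined to it by an edge other than the exceptional one of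
    -- the cut in question.
    y-side : t y ≢ far
    y-side y-far with D.near-nbr D.near-end (~-sym y~x)
    ... | inj₁ y-near           = contradiction (trans (sym y-near) y-far) λ ()
    ... | inj₂ (inj₁ y-cut)     = contradiction (trans (sym y-cut) y-far) λ ()
    ... | inj₂ (inj₂ (_ , y≡z)) = y≢z y≡z

    z-side : s z ≢ near
    z-side z-near with C.far-nbr C.far-end x~z
    ... | inj₁ z-far            = contradiction (trans (sym z-far) z-near) λ ()
    ... | inj₂ (inj₁ z-cut)     = contradiction (trans (sym z-cut) z-near) λ ()
    ... | inj₂ (inj₂ (_ , z≡y)) = y≢z (sym z≡y)

    -- The opposite corner has at most m vertices and would separate near ∩ far from x.
    near∩far-empty : ∀ {v} → s v ≡ near → t v ≢ far
    near∩far-empty {v} v-near v-far = no-small-separation G kconn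
      {D = λ p → t p ≡ far × s p ≡ near}
      (λ p → T? (corner (t p) (s p))) (corner⇒∈V D C) ∣opposite∣≤m closed
      (C.¬out⇒∈V (λ v-out → contradiction (trans (sym v-near) v-out) λ ())) (v-far , v-near)
      (λ corn → subst T (cong₂ corner v-far v-near) corn)
      (~⇒∈V x~z) (λ (_ , x-near) → contradiction (trans (sym x-near) C.far-end) λ ())
      (λ corn → subst T (cong₂ corner D.near-end C.far-end) corn)
      where
      ∣opposite∣≤m : sum (λ p → ⟦ corner (t p) (s p) ⟧) ≤ m
      -- Submodularity allows `2m` for both corners, of which the first takes at least `m`.
      ∣opposite∣≤m = ℕ.+-cancelˡ-≤ m _ m
        (ℕ.≤-trans (ℕ.+-monoˡ-≤ _ m≤∣corner∣) (∣corner∣+∣corner∣≤2m C D))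

      closed : ∀ {p q} → t p ≡ far × s p ≡ near → p ~ q →
               (t q ≡ far × s q ≡ near) ⊎ T (corner (t q) (s q))
      closed (p-far , p-near) p~q with far∩near-nbr D C p-far p-near p~q
      ... | inj₁ q-in                          = inj₁ q-in
      ... | inj₂ (inj₁ corn)                   = inj₂ corn
      ... | inj₂ (inj₂ (inj₁ (refl , _)))      = contradiction p-near z-side
      ... | inj₂ (inj₂ (inj₂ (refl , _)))      = contradiction p-far y-side

    -- The far side of `t` and the corner are disjoint and lie within the far side and the cut of
    -- `s`, where the corner has at least `m` vertices and the cut exactly `m`. Strictness comes
    -- from `x`, which is far for `s` but neither far for `t` nor in the corner.
    far-decreasing : ∣far∣ t < ∣far∣ s
    far-decreasing = ℕ.+-cancelʳ-< m _ _ (begin-strict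
      ∣far∣ t + m                  ≤⟨ ℕ.+-monoʳ-≤ (∣far∣ t) m≤∣corner∣ ⟩
      ∣far∣ t + ∣corner∣           <⟨ ℕ.n<1+n _ ⟩
      1 + (∣far∣ t + ∣corner∣)
        ≡⟨ cong₂ _+_ (∑-singleton x) (∑-distrib-+ (λ v → ⟦ isFar (t v) ⟧) (λ v → ⟦ corner (s v) (t v) ⟧)) ⟨
      sum (λ v → 𝟙 (v ≟ x)) + sum (λ v → ⟦ isFar (t v) ⟧ + ⟦ corner (s v) (t v) ⟧)
        ≡⟨ ∑-distrib-+ (λ v → 𝟙 (v ≟ x)) (λ v → ⟦ isFar (t v) ⟧ + ⟦ corner (s v) (t v) ⟧) ⟨
      sum (λ v → 𝟙 (v ≟ x) + (⟦ isFar (t v) ⟧ + ⟦ corner (s v) (t v) ⟧))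
        ≤⟨ ∑-mono _ _ pointwise ⟩
      sum (λ v → ⟦ isFar (s v) ⟧ + ⟦ isCut (s v) ⟧)
        ≡⟨ ∑-distrib-+ (λ v → ⟦ isFar (s v) ⟧) (λ v → ⟦ isCut (s v) ⟧) ⟩
      ∣far∣ s + sum (λ v → ⟦ isCut (s v) ⟧)
        ≡⟨ cong (λ i → ∣far∣ s + i) C.size ⟩
      ∣far∣ s + m                  ∎)
      where
      open ℕ.≤-Reasoning

      pointwise : ∀ v → 𝟙 (v ≟ x) + (⟦ isFar (t v) ⟧ + ⟦ corner (s v) (t v) ⟧) ≤
                        ⟦ isFar (s v) ⟧ + ⟦ isCut (s v) ⟧
      pointwise v with v ≟ x
      ... | yes refl rewrite C.far-end | D.near-end = ℕ.≤-refl
      ... | no _ = far+corner≤far+cut (s v) (t v) near∩far-empty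
                     (λ v-out v-far → C.out⇒∉V v-out (D.¬out⇒∈V λ v-out′ →
                        contradiction (trans (sym v-far) v-out′) λ ()))

-- Cuts from separators of `G - uv`

sideOf : ∀ {A B C : Set} → Dec A → Dec B → Dec C → Side
sideOf (no _)  _       _       = out
sideOf (yes _) (yes _) _       = cut
sideOf (yes _) (no _)  (yes _) = near
sideOf (yes _) (no _)  (no _)  = far

module _ {A B C : Set} where

  sideOf-near⁺ : (a? : Dec A) (b? : Dec B) (c? : Dec C) → A → ¬ B → C → sideOf a? b? c? ≡ near
  sideOf-near⁺ (yes _) (no _)  (yes _) a ¬b c = refl
  sideOf-near⁺ (yes _) (no _)  (no ¬c) a ¬b c = contradiction c ¬c
  sideOf-near⁺ (yes _) (yes b) _       a ¬b c = contradiction b ¬b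
  sideOf-near⁺ (no ¬a) _       _       a ¬b c = contradiction a ¬a

  sideOf-far⁺ : (a? : Dec A) (b? : Dec B) (c? : Dec C) → A → ¬ B → ¬ C → sideOf a? b? c? ≡ far
  sideOf-far⁺ (yes _) (no _)  (no _)  a ¬b ¬c = refl
  sideOf-far⁺ (yes _) (no _)  (yes c) a ¬b ¬c = contradiction c ¬c
  sideOf-far⁺ (yes _) (yes b) _       a ¬b ¬c = contradiction b ¬b
  sideOf-far⁺ (no ¬a) _       _       a ¬b ¬c = contradiction a ¬a

  sideOf-cut⁺ : (a? : Dec A) (b? : Dec B) (c? : Dec C) → A → B → sideOf a? b? c? ≡ cut
  sideOf-cut⁺ (yes _) (yes _) _ a b = refl
  sideOf-cut⁺ (yes _) (no ¬b) _ a b = contradiction b ¬b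
  sideOf-cut⁺ (no ¬a) _       _ a b = contradiction a ¬a

  sideOf-near⁻ : (a? : Dec A) (b? : Dec B) (c? : Dec C) → sideOf a? b? c? ≡ near → ¬ B × C
  sideOf-near⁻ (yes _) (no ¬b) (yes c) _ = ¬b , c

  sideOf-far⁻ : (a? : Dec A) (b? : Dec B) (c? : Dec C) → sideOf a? b? c? ≡ far → ¬ B × ¬ C
  sideOf-far⁻ (yes _) (no ¬b) (no ¬c) _ = ¬b , ¬c

  sideOf-out⁻ : (a? : Dec A) (b? : Dec B) (c? : Dec C) → sideOf a? b? c? ≡ out → ¬ A
  sideOf-out⁻ (no ¬a) _ _ _ = ¬a
  sideOf-out⁻ (yes _) (yes _) _ ()
  sideOf-out⁻ (yes _) (no _) (yes _) ()
  sideOf-out⁻ (yes _) (no _) (no _) ()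

  sideOf-¬out⁻ : (a? : Dec A) (b? : Dec B) (c? : Dec C) → sideOf a? b? c? ≢ out → A
  sideOf-¬out⁻ (yes a) _ _ _ = a
  sideOf-¬out⁻ (no _)  _ _ ¬out = contradiction refl ¬out

  isCut-sideOf : (a? : Dec A) (b? : Dec B) (c? : Dec C) → (B → A) → ⟦ isCut (sideOf a? b? c?) ⟧ ≡ 𝟙 b?
  isCut-sideOf (yes _) (yes _) _       B⇒A = refl
  isCut-sideOf (yes _) (no _)  (yes _) B⇒A = refl
  isCut-sideOf (yes _) (no _)  (no _)  B⇒A = refl
  isCut-sideOf (no ¬a) (yes b) _       B⇒A = contradiction (B⇒A b) ¬a
  isCut-sideOf (no _)  (no _)  _       B⇒A = refl

module _ (G : Graph N) {u v : Fin N} (S : Subset N) (S⊆V : S ⊆ Graph.V G) where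
  open Graph G

  private
    G∖S H∖S : Graph N
    G∖S = deleteVertices G S
    H∖S = deleteVertices (deleteEdge G u v) S

    IsUV : Rel (Fin N) 0ℓ
    IsUV p q = (p ≡ u × q ≡ v) ⊎ (p ≡ v × q ≡ u)

    IsUV? : B.Decidable IsUV
    IsUV? p q = ((p ≟ u) ×-dec (q ≟ v)) ⊎-dec ((p ≟ v) ×-dec (q ≟ u))

  module _ (u~v : u ~ v) (conn : Connected G∖S) (disc : Disconnected H∖S)
           (reach? : ∀ p → Dec (Reachable H∖S u p)) where

    private
      side : Fin N → Side
      side p = sideOf (p ∈? V) (p ∈? S) (reach? p)

      -- If the edge `uv` could always be replaced by a walk in `H∖S`, walks of `G∖S` would become
      -- walks of `H∖S`, which is disconnected. The requirement is vacuous when an end of the edge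
      -- lies in `S`, so both ends avoid `S`.
      not-bypassed : ¬ (∀ {p q} → IsUV p q → p ∉ S → q ∉ S → Reachable H∖S p q)
      not-bypassed bypass = disc λ p∈ q∈ → kleisliStar id step (conn p∈ q∈)
        where
        step : ∀ {p q} → p ~ q × p ∉ S × q ∉ S → Reachable H∖S p q
        step {p} {q} (p~q , p∉S , q∉S) with IsUV? p q
        ... | yes uv = bypass uv p∉S q∉S
        ... | no ¬uv = return ((p~q , ¬uv) , p∉S , q∉S)

      u∉S : u ∉ S
      u∉S u∈S = not-bypassed λ
        { (inj₁ (refl , _)) p∉S _ → contradiction u∈S p∉S
        ; (inj₂ (_ , refl)) _ q∉S → contradiction u∈S q∉S }

      v∉S : v ∉ S
      v∉S v∈S = not-bypassed λ
        { (inj₁ (_ , refl)) _ q∉S → contradiction v∈S q∉S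
        ; (inj₂ (refl , _)) p∉S _ → contradiction v∈S p∉S }

      ¬u⇝v : ¬ Reachable H∖S u v
      ¬u⇝v u⇝v = not-bypassed λ
        { (inj₁ (refl , refl)) _ _ → u⇝v
        ; (inj₂ (refl , refl)) _ _ → reverse (Graph.~-sym H∖S) u⇝v }

      near⁺ : ∀ {p} → p ∈ V → p ∉ S → Reachable H∖S u p → side p ≡ near
      near⁺ {p} = sideOf-near⁺ (p ∈? V) (p ∈? S) (reach? p)

      far⁺ : ∀ {p} → p ∈ V → p ∉ S → ¬ Reachable H∖S u p → side p ≡ far
      far⁺ {p} = sideOf-far⁺ (p ∈? V) (p ∈? S) (reach? p)

      cut⁺ : ∀ {p} → p ∈ S → side p ≡ cut
      cut⁺ {p} p∈S = sideOf-cut⁺ (p ∈? V) (p ∈? S) (reach? p) (S⊆V p∈S) p∈S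

      near-nbr : ∀ {p q} → side p ≡ near → p ~ q → side q ≡ near ⊎ side q ≡ cut ⊎ (p ≡ u × q ≡ v)
      near-nbr {p} {q} p-near p~q = by-cases (q ∈? S) (IsUV? p q)
        where
        p∉S = proj₁ (sideOf-near⁻ (p ∈? V) (p ∈? S) (reach? p) p-near)
        u⇝p = proj₂ (sideOf-near⁻ (p ∈? V) (p ∈? S) (reach? p) p-near)

        by-cases : Dec (q ∈ S) → Dec (IsUV p q) → side q ≡ near ⊎ side q ≡ cut ⊎ (p ≡ u × q ≡ v)
        by-cases (yes q∈S) _                     = inj₂ (inj₁ (cut⁺ q∈S))
        by-cases (no _)    (yes (inj₁ uv))       = inj₂ (inj₂ uv)
        by-cases (no _)    (yes (inj₂ (p≡v , _))) =
          contradiction (subst (Reachable H∖S u) p≡v u⇝p) ¬u⇝v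
        by-cases (no q∉S)  (no ¬uv)              =
          inj₁ (near⁺ (~⇒∈V (~-sym p~q)) q∉S (u⇝p ◅◅ return ((p~q , ¬uv) , p∉S , q∉S)))

      far-nbr : ∀ {p q} → side p ≡ far → p ~ q → side q ≡ far ⊎ side q ≡ cut ⊎ (p ≡ v × q ≡ u)
      far-nbr {p} {q} p-far p~q = by-cases (q ∈? S) (IsUV? p q)
        where
        p∉S  = proj₁ (sideOf-far⁻ (p ∈? V) (p ∈? S) (reach? p) p-far)
        ¬u⇝p = proj₂ (sideOf-far⁻ (p ∈? V) (p ∈? S) (reach? p) p-far)

        by-cases : Dec (q ∈ S) → Dec (IsUV p q) → side q ≡ far ⊎ side q ≡ cut ⊎ (p ≡ v × q ≡ u)
        by-cases (yes q∈S) _                     = inj₂ (inj₁ (cut⁺ q∈S))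
        by-cases (no _)    (yes (inj₂ vu))       = inj₂ (inj₂ vu)
        by-cases (no _)    (yes (inj₁ (p≡u , _))) =
          contradiction (subst (Reachable H∖S u) (sym p≡u) ε) ¬u⇝p
        by-cases (no q∉S)  (no ¬uv)              =
          inj₁ (far⁺ (~⇒∈V (~-sym p~q)) q∉S λ u⇝q →
            ¬u⇝p (u⇝q ◅◅ return (Graph.~-sym H∖S ((p~q , ¬uv) , p∉S , q∉S))))

    -- The near side is what `u` reaches in `H∖S`. An edge of `G∖S` leaving it has been deleted from
    -- `H∖S`, so it is `uv`.
    separator-cut : ∃ (IsCutOf G ∣ S ∣ u v)
    separator-cut = side , record
      { near-end = near⁺ (~⇒∈V u~v) u∉S ε
      ; far-end  = far⁺ (~⇒∈V (~-sym u~v)) v∉S ¬u⇝v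
      ; near-nbr = near-nbr
      ; far-nbr  = far-nbr
      ; out⇒∉V   = λ {p} → sideOf-out⁻ (p ∈? V) (p ∈? S) (reach? p)
      ; ¬out⇒∈V  = λ {p} → sideOf-¬out⁻ (p ∈? V) (p ∈? S) (reach? p)
      ; size     = trans (sum-cong-≗ (λ p → isCut-sideOf (p ∈? V) (p ∈? S) (reach? p) S⊆V)) (sym (∣p∣≡∑ S))
      }

¬¬-Fin : {P : Pred (Fin n) 0ℓ} → (∀ i → ¬ ¬ P i) → ¬ ¬ (∀ i → P i)
¬¬-Fin = sequence (RawMonad.rawApplicative ¬¬-Monad)

-- Deleting an edge keeps the order, so connectivity can fail only through an `m`-separator of
-- `G - uv`, and this set does not separate `G`. Connectedness of the rest of `G` and decisions of
-- reachability are obtained inside the refutation.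
¬¬-cut : (G : Graph N) → IsConnected (suc m) G → ∀ {u v} → Graph._~_ G u v →
         ¬ IsConnected (suc m) (deleteEdge G u v) → ¬ ¬ ∃ (IsCutOf G m u v)
¬¬-cut G kconn u~v ¬kconn ¬cut = ¬kconn (proj₁ kconn , λ (S , S⊆V , ∣S∣≡m , disc) →
  proj₂ kconn (S , S⊆V , ∣S∣≡m , λ conn → ¬¬-Fin (λ p → ¬¬-excluded-middle) λ reach? →
    ¬cut (subst (λ k → ∃ (IsCutOf G k _ _)) ∣S∣≡m (separator-cut G S S⊆V u~v conn disc reach?))))

-- Counting edges

x∈p─q⇒x∉q : (p q : Subset n) → ∀ {x} → x ∈ p ─ q → x ∉ q
x∈p─q⇒x∉q (_ ∷ p) (inside  ∷ q) (there x∈) (there x∈q) = x∈p─q⇒x∉q p q x∈ x∈q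
x∈p─q⇒x∉q (_ ∷ p) (outside ∷ q) (there x∈) (there x∈q) = x∈p─q⇒x∉q p q x∈ x∈q

∑𝟙-× : {P : Set} {Q : Pred (Fin n) 0ℓ} (P? : Dec P) (Q? : Decidable Q) →
       sum (λ i → 𝟙 (P? ×-dec Q? i)) ≡ 𝟙 P? * sum (𝟙 ∘ Q?)
∑𝟙-× (yes p) Q? = sym (ℕ.+-identityʳ _)
∑𝟙-× (no ¬p) Q? = ∑𝟙-empty (λ i → no ¬p ×-dec Q? i) (λ i → ¬p ∘ proj₁)

length-filter-tabulate : {P : Pred A 0ℓ} (P? : Decidable P) (f : Fin n → A) →
                         length (filter P? (tabulate f)) ≡ sum (λ i → 𝟙 (P? (f i)))
length-filter-tabulate {n = zero}  P? f = refl
length-filter-tabulate {n = suc n} P? f with does (P? (f zero))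
... | true  = cong suc (length-filter-tabulate P? (f ∘ suc))
... | false = length-filter-tabulate P? (f ∘ suc)

-- Translates the list of edges into the double sums in which all other counts are expressed.
length-filter-cartesianProduct : {P : Pred (A × B) 0ℓ} (P? : Decidable P) (f : Fin m → A) (g : Fin n → B) →
  length (filter P? (cartesianProduct (tabulate f) (tabulate g))) ≡
  sum (λ i → sum (λ j → 𝟙 (P? (f i , g j))))
length-filter-cartesianProduct {m = zero}  P? f g = refl
length-filter-cartesianProduct {m = suc m} P? f g = begin
  length (filter P? (map (f zero ,_) (tabulate g) ++ rest))
    ≡⟨ cong length (filter-++ P? (map (f zero ,_) (tabulate g)) rest) ⟩
  length (filter P? (map (f zero ,_) (tabulate g)) ++ filter P? rest)
    ≡⟨ length-++ (filter P? (map (f zero ,_) (tabulate g))) ⟩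
  length (filter P? (map (f zero ,_) (tabulate g))) + length (filter P? rest)
    ≡⟨ cong₂ _+_
         (trans (cong (length ∘ filter P?) (map-tabulate g (f zero ,_)))
                (length-filter-tabulate P? (λ j → f zero , g j)))
         (length-filter-cartesianProduct P? (f ∘ suc) g) ⟩
  sum (λ i → sum (λ j → 𝟙 (P? (f i , g j)))) ∎
  where
  open ≡-Reasoning
  rest = cartesianProduct (tabulate (f ∘ suc)) (tabulate g)

length-filter-filter : {P Q : Pred A 0ℓ} (P? : Decidable P) (Q? : Decidable Q) (xs : List A) →
  length (filter P? (filter Q? xs)) ≡ length (filter (λ x → Q? x ×-dec P? x) xs)
length-filter-filter P? Q? [] = refl
length-filter-filter P? Q? (x ∷ xs) with does (Q? x)
... | false = length-filter-filter P? Q? xs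
... | true with does (P? x)
...   | true  = cong suc (length-filter-filter P? Q? xs)
...   | false = length-filter-filter P? Q? xs

module _ (G : Graph N) (kconn : IsConnected (suc m) G) where
  open Graph G
  private
    k : ℕ
    k = suc m

    Vₖ : Subset N
    Vₖ = verticesOfDegree k G

    F : Graph N
    F = deleteVertices G Vₖ

    deg : Fin N → ℕ
    deg = degree G

    ∈Vₖ⁻ : ∀ {v} → v ∈ Vₖ → v ∈ V × deg v ≡ k
    ∈Vₖ⁻ = ∈-comprehension⁻ (λ v → (v ∈? V) ×-dec (deg v ℕ.≟ k))

    ∈Vₖ⁺ : ∀ {v} → v ∈ V → deg v ≡ k → v ∈ Vₖ
    ∈Vₖ⁺ v∈V eq = ∈-comprehension⁺ (λ v → (v ∈? V) ×-dec (deg v ℕ.≟ k)) (v∈V , eq)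

    ∈F⁻ : ∀ {v} → v ∈ Graph.V F → v ∈ V × v ∉ Vₖ
    ∈F⁻ v∈F = p─q⊆p V Vₖ v∈F , x∈p─q⇒x∉q V Vₖ v∈F

    ∈F⁺ : ∀ {v} → v ∈ V → v ∉ Vₖ → v ∈ Graph.V F
    ∈F⁺ = x∈p∧x∉q⇒x∈p─q

    deg-∈F : ∀ {v} → v ∈ V → v ∉ Vₖ → k < deg v
    deg-∈F v∈V v∉Vₖ = ℕ.≤∧≢⇒< (minDegree G kconn v∈V) (v∉Vₖ ∘ ∈Vₖ⁺ v∈V ∘ sym)

    deg-sum : ∀ v → deg v ≡ sum (λ u → 𝟙 (v ~? u))
    deg-sum v = ∣comprehension∣ (v ~?_)

    KK? : B.Decidable (λ u v → u ~ v × (u ∈ Vₖ × v ∈ Vₖ))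
    KK? u v = (u ~? v) ×-dec ((u ∈? Vₖ) ×-dec (v ∈? Vₖ))

    KF? : B.Decidable (λ u v → u ~ v × (u ∈ Vₖ × v ∉ Vₖ))
    KF? u v = (u ~? v) ×-dec ((u ∈? Vₖ) ×-dec ¬? (v ∈? Vₖ))

    ∑∑ : (Fin N → Fin N → ℕ) → ℕ
    ∑∑ f = sum (λ u → sum (λ v → f u v))

    -- The number of edges between `Vₖ` and `F`: each is counted once, from its end in `Vₖ`.
    X : ℕ
    X = ∑∑ (λ u v → 𝟙 (KF? u v))

    order-split : order G ≡ ∣ Vₖ ∣ + order F
    order-split = begin
      ∣ V ∣ ≡⟨ ∣p∣≡∑ V ⟩
      sum (λ v → 𝟙 (v ∈? V))
        ≡⟨ sum-cong-≗ (λ v → 𝟙-split (v ∈? V) (v ∈? Vₖ) (v ∈? Graph.V F)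
             (split v) (proj₁ ∘ ∈Vₖ⁻) (proj₁ ∘ ∈F⁻) (λ v∈Vₖ v∈F → proj₂ (∈F⁻ v∈F) v∈Vₖ)) ⟩
      sum (λ v → 𝟙 (v ∈? Vₖ) + 𝟙 (v ∈? Graph.V F))
        ≡⟨ ∑-distrib-+ (λ v → 𝟙 (v ∈? Vₖ)) (λ v → 𝟙 (v ∈? Graph.V F)) ⟩
      sum (λ v → 𝟙 (v ∈? Vₖ)) + sum (λ v → 𝟙 (v ∈? Graph.V F))
        ≡⟨ cong₂ _+_ (∣p∣≡∑ Vₖ) (∣p∣≡∑ (Graph.V F)) ⟨
      ∣ Vₖ ∣ + order F ∎
      where
      open ≡-Reasoning
      split : ∀ v → v ∈ V → v ∈ Vₖ ⊎ v ∈ Graph.V F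
      split v v∈V with v ∈? Vₖ
      ... | yes v∈Vₖ = inj₁ v∈Vₖ
      ... | no v∉Vₖ  = inj₂ (∈F⁺ v∈V v∉Vₖ)

    degreeSum : ∀ {P : Pred (Fin N) 0ℓ} (P? : Decidable P) →
                sum (λ u → 𝟙 (P? u) * deg u) ≡ ∑∑ (λ u v → 𝟙 (P? u ×-dec (u ~? v)))
    degreeSum P? = sum-cong-≗ λ u →
      trans (cong (𝟙 (P? u) *_) (deg-sum u)) (sym (∑𝟙-× (P? u) (u ~?_)))

    ∑∑-+ : (f g h : Fin N → Fin N → ℕ) → (∀ u v → f u v ≡ g u v + h u v) → ∑∑ f ≡ ∑∑ g + ∑∑ h
    ∑∑-+ f g h eq = trans
      (sum-cong-≗ (λ u → trans (sum-cong-≗ (eq u)) (∑-distrib-+ (g u) (h u))))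
      (∑-distrib-+ (λ u → sum (g u)) (λ u → sum (h u)))

    edgeCount : ∑∑ (λ u v → 𝟙 (KK? u v)) ≡ 2 * length (edgesOfDegree k G)
    edgeCount = trans
      (∑∑-orientation {H = λ u v → (u Fin.< v × u ~ v) × (u ∈ Vₖ × v ∈ Vₖ)} KK?
        (λ u v → ((u <? v) ×-dec (u ~? v)) ×-dec ((u ∈? Vₖ) ×-dec (v ∈? Vₖ)))
        orient
        (λ ((_ , u~v) , uv) → u~v , uv)
        (λ ((_ , u~v) , u∈ , v∈) → ~-sym u~v , v∈ , u∈)
        (λ ((u<v , _) , _) ((v<u , _) , _) → Fin.<-asym u<v v<u))
      (cong (2 *_) (sym (trans
        (length-filter-filter (λ (u , v) → (u ∈? Vₖ) ×-dec (v ∈? Vₖ))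
          (λ (u , v) → (u <? v) ×-dec (u ~? v)) (cartesianProduct (allFin N) (allFin N)))
        (length-filter-cartesianProduct
          (λ (u , v) → ((u <? v) ×-dec (u ~? v)) ×-dec ((u ∈? Vₖ) ×-dec (v ∈? Vₖ))) id id))))
      where
      orient : ∀ {u v} → u ~ v × (u ∈ Vₖ × v ∈ Vₖ) →
               ((u Fin.< v × u ~ v) × (u ∈ Vₖ × v ∈ Vₖ)) ⊎ ((v Fin.< u × v ~ u) × (v ∈ Vₖ × u ∈ Vₖ))
      orient {u} {v} (u~v , u∈ , v∈) with <-cmp u v
      ... | tri< u<v _ _ = inj₁ ((u<v , u~v) , u∈ , v∈)
      ... | tri≈ _ u≡v _ = contradiction u~v (~-irrefl u≡v)
      ... | tri> _ _ v<u = inj₂ ((v<u , ~-sym u~v) , v∈ , u∈)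

    -- Handshake count from `Vₖ`: edges inside are met from both ends, edges to `F` once.
    degreeSum-Vₖ : ∣ Vₖ ∣ * k ≡ 2 * length (edgesOfDegree k G) + X
    degreeSum-Vₖ = begin
      ∣ Vₖ ∣ * k                            ≡⟨ cong (_* k) (∣p∣≡∑ Vₖ) ⟩
      sum (λ u → 𝟙 (u ∈? Vₖ)) * k           ≡⟨ *-distribʳ-sum k (λ u → 𝟙 (u ∈? Vₖ)) ⟩
      sum (λ u → 𝟙 (u ∈? Vₖ) * k)           ≡⟨ sum-cong-≗ (λ u → deg≡k (u ∈? Vₖ)) ⟩
      sum (λ u → 𝟙 (u ∈? Vₖ) * deg u)       ≡⟨ degreeSum (_∈? Vₖ) ⟩
      ∑∑ (λ u v → 𝟙 ((u ∈? Vₖ) ×-dec (u ~? v)))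
        ≡⟨ ∑∑-+ _ _ _ (λ u v → 𝟙-split ((u ∈? Vₖ) ×-dec (u ~? v)) (KK? u v) (KF? u v)
             (split v) (λ (u~v , u∈ , _) → u∈ , u~v) (λ (u~v , u∈ , _) → u∈ , u~v)
             (λ (_ , _ , v∈) (_ , _ , v∉) → v∉ v∈)) ⟩
      ∑∑ (λ u v → 𝟙 (KK? u v)) + X          ≡⟨ cong (_+ X) edgeCount ⟩
      2 * length (edgesOfDegree k G) + X    ∎
      where
      open ≡-Reasoning
      deg≡k : ∀ {u} (u∈? : Dec (u ∈ Vₖ)) → 𝟙 u∈? * k ≡ 𝟙 u∈? * deg u
      deg≡k (yes u∈) = cong (1 *_) (sym (proj₂ (∈Vₖ⁻ u∈)))
      deg≡k (no _)   = refl

      split : ∀ {u} v → u ∈ Vₖ × u ~ v → (u ~ v × (u ∈ Vₖ × v ∈ Vₖ)) ⊎ (u ~ v × (u ∈ Vₖ × v ∉ Vₖ))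
      split v (u∈ , u~v) with v ∈? Vₖ
      ... | yes v∈ = inj₁ (u~v , u∈ , v∈)
      ... | no v∉  = inj₂ (u~v , u∈ , v∉)

    -- The count from the other side; exchanging the summations turns the edges from `F` to `Vₖ`
    -- into the same `X`.
    degreeSum-F : sum (λ u → 𝟙 (u ∈? Graph.V F) * deg u) ≡ X + ∑∑ (λ u v → 𝟙 (Graph._~?_ F u v))
    degreeSum-F = begin
      sum (λ u → 𝟙 (u ∈? Graph.V F) * deg u)  ≡⟨ degreeSum (_∈? Graph.V F) ⟩
      ∑∑ (λ u v → 𝟙 ((u ∈? Graph.V F) ×-dec (u ~? v)))
        ≡⟨ ∑∑-+ _ _ _ (λ u v → 𝟙-split ((u ∈? Graph.V F) ×-dec (u ~? v)) (KF? v u) (Graph._~?_ F u v)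
             (split v)
             (λ (v~u , _ , u∉) → ∈F⁺ (~⇒∈V (~-sym v~u)) u∉ , ~-sym v~u)
             (λ (u~v , u∉ , _) → ∈F⁺ (~⇒∈V u~v) u∉ , u~v)
             (λ (_ , v∈ , _) (_ , _ , v∉) → v∉ v∈)) ⟩
      ∑∑ (λ u v → 𝟙 (KF? v u)) + ∑∑ (λ u v → 𝟙 (Graph._~?_ F u v))
        ≡⟨ cong (_+ ∑∑ (λ u v → 𝟙 (Graph._~?_ F u v))) (∑-comm (λ u v → 𝟙 (KF? v u))) ⟩
      X + ∑∑ (λ u v → 𝟙 (Graph._~?_ F u v)) ∎
      where
      open ≡-Reasoning
      split : ∀ {u} v → u ∈ Graph.V F × u ~ v →
              (v ~ u × (v ∈ Vₖ × u ∉ Vₖ)) ⊎ (u ~ v × u ∉ Vₖ × v ∉ Vₖ)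
      split v (u∈F , u~v) with v ∈? Vₖ
      ... | yes v∈ = inj₁ (~-sym u~v , v∈ , proj₂ (∈F⁻ u∈F))
      ... | no v∉  = inj₂ (u~v , proj₂ (∈F⁻ u∈F) , v∉)

    -- Every vertex of `F` has degree at least `k + 1`, and the total excess dominates that of each
    -- single vertex. If the maximum degree is attained in `Vₖ`, the truncated difference is zero.
    degreeSum-F≥ : order F * (k + 1) + (maxDegree G ∸ (k + 1)) ≤ sum (λ u → 𝟙 (u ∈? Graph.V F) * deg u)
    degreeSum-F≥ = begin
      order F * (k + 1) + (maxDegree G ∸ (k + 1))
        ≡⟨ cong (_+ (maxDegree G ∸ (k + 1))) (trans (cong (_* (k + 1)) (∣p∣≡∑ (Graph.V F)))
             (*-distribʳ-sum (k + 1) (λ u → 𝟙 (u ∈? Graph.V F)))) ⟩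
      sum (λ u → 𝟙 (u ∈? Graph.V F) * (k + 1)) + (maxDegree G ∸ (k + 1))
        ≤⟨ ℕ.+-monoʳ-≤ _ (ℕ.m≤n+o⇒m∸n≤o _ (k + 1) maxDegree≤) ⟩
      sum (λ u → 𝟙 (u ∈? Graph.V F) * (k + 1)) + sum excess
        ≡⟨ ∑-distrib-+ (λ u → 𝟙 (u ∈? Graph.V F) * (k + 1)) excess ⟨
      sum (λ u → 𝟙 (u ∈? Graph.V F) * (k + 1) + excess u)
        ≡⟨ sum-cong-≗ (λ u → split (u ∈? Graph.V F)) ⟩
      sum (λ u → 𝟙 (u ∈? Graph.V F) * deg u) ∎
      where
      open ℕ.≤-Reasoning
      excess : Fin N → ℕ
      excess u = 𝟙 (u ∈? Graph.V F) * (deg u ∸ (k + 1))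

      k+1≤deg : ∀ {u} → u ∈ Graph.V F → k + 1 ≤ deg u
      k+1≤deg u∈F = ℕ.≤-trans (ℕ.≤-reflexive (ℕ.+-comm k 1))
        (deg-∈F (proj₁ (∈F⁻ u∈F)) (proj₂ (∈F⁻ u∈F)))

      split : ∀ {u} (u∈? : Dec (u ∈ Graph.V F)) →
              𝟙 u∈? * (k + 1) + 𝟙 u∈? * (deg u ∸ (k + 1)) ≡ 𝟙 u∈? * deg u
      split (no _) = refl
      split {u} (yes u∈F) = trans (sym (ℕ.*-distribˡ-+ 1 (k + 1) (deg u ∸ (k + 1))))
        (cong (1 *_) (ℕ.m+[n∸m]≡n (k+1≤deg u∈F)))

      deg≤ : ∀ {u} → u ∈ V → deg u ≤ k + 1 + sum excess
      deg≤ {u} u∈V with u ∈? Vₖ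
      ... | yes u∈Vₖ = ℕ.≤-trans (ℕ.≤-reflexive (proj₂ (∈Vₖ⁻ u∈Vₖ)))
                         (ℕ.≤-trans (ℕ.m≤m+n k 1) (ℕ.m≤m+n (k + 1) _))
      ... | no u∉Vₖ  = ℕ.≤-trans (ℕ.m≤n+m∸n (deg u) (k + 1)) (ℕ.+-monoʳ-≤ (k + 1) (ℕ.≤-trans
        (ℕ.≤-reflexive (sym (trans (cong (_* (deg u ∸ (k + 1))) (𝟙-yes (u ∈? Graph.V F) (∈F⁺ u∈V u∉Vₖ)))
                                   (ℕ.*-identityˡ _))))
        (term≤∑ excess u)))

      maxDegree≤ : maxDegree G ≤ k + 1 + sum excess
      maxDegree≤ = max≤v⁺ z≤n (All.map⁺ (All.map deg≤ (All.all-filter (_∈? V) (allFin N))))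

  module _ (cuts : ∀ u v → ∃ λ side → u ~ v → IsCutOf G m u v side) where

    private
      -- Defined on all pairs, since `cuts` supplies a side assignment even for a non-edge; that it
      -- is a cut is claimed only along edges.
      weight : Fin N → Fin N → ℕ
      weight u v = ∣far∣ (proj₁ (cuts u v))

      weight-decreasing : ∀ {y x z} → Graph._~_ F y x → Graph._~_ F x z → y ≢ z →
                          weight x z < weight y x
      weight-decreasing {y} {x} {z} (y~x , _ , x∉Vₖ) (x~z , _) y≢z =
        far-decreasing kconn (proj₂ (cuts y x) y~x) (proj₂ (cuts x z) x~z)
          y~x x~z y≢z (deg-∈F (~⇒∈V x~z) x∉Vₖ)

    -- Three facts are added: `f * (k + 1) + δ ≤ X + ff`, `ff + 2 * c ≤ 2 * f` and
    -- `a * k ≡ 2 * e + X`. The summand `m * a` completes `m * f` to `m * order G` and `a * k` to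
    -- `a * (2 * k ∸ 1)`.
    numerator≤ : ∀ {c} → HasComponentCount F c →
      m * order G + 2 * (c + length (edgesOfDegree k G)) + (maxDegree G ∸ (k + 1)) ≤ ∣ Vₖ ∣ * (2 * k ∸ 1)
    -- `2 * f + ff` is added on both sides in place of subtractions.
    numerator≤ {c} count = ℕ.+-cancelʳ-≤ (2 * f + ff) _ _ (begin
      m * order G + 2 * (c + e) + δ + (2 * f + ff)
        ≡⟨ cong (λ n → m * n + 2 * (c + e) + δ + (2 * f + ff)) order-split ⟩
      m * (a + f) + 2 * (c + e) + δ + (2 * f + ff)
        ≡⟨ solve 7 (λ m a f c e δ ff →
             m :* (a :+ f) :+ con 2 :* (c :+ e) :+ δ :+ (con 2 :* f :+ ff) :=
             (f :* (con 1 :+ m :+ con 1) :+ δ) :+ (ff :+ con 2 :* c) :+ (m :* a :+ con 2 :* e))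
             refl m a f c e δ ff ⟩
      (f * (k + 1) + δ) + (ff + 2 * c) + (m * a + 2 * e)
        ≤⟨ ℕ.+-monoˡ-≤ (m * a + 2 * e) (ℕ.+-mono-≤
             (ℕ.≤-trans degreeSum-F≥ (ℕ.≤-reflexive degreeSum-F))
             (degreeSum+2c≤2order F weight weight-decreasing count)) ⟩
      (X + ff) + 2 * f + (m * a + 2 * e)
        ≡⟨ solve 6 (λ X m a f e ff →
             (X :+ ff) :+ con 2 :* f :+ (m :* a :+ con 2 :* e) :=
             m :* a :+ (con 2 :* e :+ X) :+ (con 2 :* f :+ ff))
             refl X m a f e ff ⟩
      m * a + (2 * e + X) + (2 * f + ff)
        ≡⟨ cong (λ n → m * a + n + (2 * f + ff)) degreeSum-Vₖ ⟨
      m * a + a * k + (2 * f + ff)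
        -- At `k = suc m` the term `2 * k ∸ 1` computes to `m + (1 + (m + 0))`.
        ≡⟨ cong (_+ (2 * f + ff)) (solve 2 (λ m a →
             m :* a :+ a :* (con 1 :+ m) := a :* (m :+ (con 1 :+ (m :+ con 0)))) refl m a) ⟩
      a * (2 * k ∸ 1) + (2 * f + ff) ∎)
      where
      open ℕ.≤-Reasoning
      open +-*-Solver
      a  = ∣ Vₖ ∣
      f  = order F
      e  = length (edgesOfDegree k G)
      δ  = maxDegree G ∸ (k + 1)
      ff = ∑∑ (λ u v → 𝟙 (Graph._~?_ F u v))

-- Removing the double negation and passing to rationals

¬¬-cuts : (G : Graph N) → IsMinimallyConnected (suc m) G →
          ¬ ¬ (∀ u v → ∃ λ side → Graph._~_ G u v → IsCutOf G m u v side)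
¬¬-cuts G (kconn , minimal) = ¬¬-Fin λ u → ¬¬-Fin λ v → pair u v
  where
  open Graph G
  pair : ∀ u v → ¬ ¬ (∃ λ side → u ~ v → IsCutOf G _ u v side)
  pair u v with u ~? v
  ... | yes u~v = ¬¬-map (λ (side , isCut) → side , λ _ → isCut) (¬¬-cut G kconn u~v (minimal u v u~v))
  ... | no ¬u~v = contradiction ((λ _ → out) , λ u~v → contradiction u~v ¬u~v)

-- Clearing denominators. The comparison takes place among unnormalised rationals, where it is an
-- integer inequality; normalising changes a fraction only up to equivalence.
/1≥/ : ∀ a b d .{{_ : NonZero d}} → b ≤ a * d → (+ a) / 1 ≥ (+ b) / d
/1≥/ a b (suc d) b≤ad = toℚᵘ-cancel-≤
  (ℚᵘ.≤-respˡ-≃ (ℚᵘ.≃-sym (toℚᵘ-fromℚᵘ (ℚᵘ.mkℚᵘ (+ b) d)))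
    (ℚᵘ.≤-respʳ-≃ (ℚᵘ.≃-sym (toℚᵘ-fromℚᵘ (ℚᵘ.mkℚᵘ (+ a) 0)))
      (ℚᵘ.*≤* (begin
        + b ℤ.* + 1     ≡⟨ ℤ.*-identityʳ (+ b) ⟩
        + b             ≤⟨ +≤+ b≤ad ⟩
        + (a * suc d)   ≡⟨ ℤ.pos-* a (suc d) ⟩
        + a ℤ.* + suc d ∎))))
  where
  open ℤ.≤-Reasoning

mainTheorem1 : ∀ {N : ℕ} (k : ℕ) .{{_ : NonZero k}} (G : Graph N) →
    IsMinimallyConnected k G →
    (c : ℕ) → HasComponentCount (deleteVertices G (verticesOfDegree k G)) c →
    ((+ ∣ verticesOfDegree k G ∣) / 1) ≥
    _/_ (+ ((k ∸ 1) * order G + 2 * (c + length (edgesOfDegree k G)) + (maxDegree G ∸ (k + 1))))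
    (2 * k ∸ 1) {{2k∸1-nonZero k}}
mainTheorem1 (suc m) G minimal c count =
  /1≥/ ∣ verticesOfDegree (suc m) G ∣ _ (2 * suc m ∸ 1) {{2k∸1-nonZero (suc m)}}
    -- The order on natural numbers is decidable, so the inequality follows from its double
    -- negation.
    (decidable-stable (_ ℕ.≤? _)
      (¬¬-map (λ cuts → numerator≤ G (proj₁ minimal) cuts count) (¬¬-cuts G minimal)))
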